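{- Let $T=\{t_1,\ldots,t_N\}$ be documents, each containing at most $L$ distinct words from a dictionary $\{w_1,\ldots,w_D\}$ ($D\ge2$). For a word $w$ let $\#(w)$ be the number of documents containing $w$. Fix $\epsilon\in(0,1]$ and $p=2\log D$. Consider the mapper that, for every document $t$ and every unordered pair of distinct words $(w_1,w_2)$ in $t$, independently emits $((w_1,w_2)\to1)$ with probability $\min\!\left(1,\frac{p}{\epsilon}\frac{1}{\min(\#(w_1),\#(w_2))}\right)$ (OverlapSampleEmit). Then the expected total number of emitted pairs (shuffle size) is $O(DL\log(D)/\epsilon)$, independently of $N$.
   Context: This sampling scheme is used to estimate the overlap similarity $\frac{\#(x,y)}{\min(\#(x),\#(y))}$, where $\#(x,y)$ is the number of documents containing both $x$ and $y$. $\log$ denotes the natural logarithm. -}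

module Defs where

open import Data.Bool.Base using (Bool; true; false; if_then_else_)
open import Data.Fin.Base using (Fin)
open import Data.Fin.Properties using () renaming (_<?_ to _<ᶠ?_)
open import Data.Fin.Subset using (Subset)
open import Data.Fin.Subset.Properties using (_∈?_)
open import Data.Integer.Base as ℤ using (+_)
import Data.Integer.Properties as ℤ
open import Data.Integer.Tactic.RingSolver using () renaming (solve-∀ to ℤ-solve-∀)
open import Data.List.Base as List
  using (List; []; _∷_; _++_; length; filter; cartesianProduct; allFin)
open import Data.Nat.Base as ℕ using (ℕ; zero; suc)
import Data.Nat.Properties as ℕ
open import Data.Nat.Tactic.RingSolver using (solve-∀)
open import Data.Product.Base using (Σ-syntax; ∃-syntax; _×_; _,_; proj₁; proj₂)
open import Data.Rational.Base
  using (ℚ; 0ℚ; 1ℚ; ½; mkℚ; toℚᵘ; _/_; 1/_; _+_; _*_; _-_; -_; _⊓_; _⊔_; ∣_∣;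
         _≤_; _<_; Positive; positive; nonNegative; ↧ₙ_)
open import Data.Rational.Properties
open import Data.Rational.Solver using (module +-*-Solver)
import Data.Rational.Unnormalised.Base as ℚᵘ
import Data.Rational.Unnormalised.Properties as ℚᵘ
open import Data.Sum.Base using (inj₁; inj₂)
open import Data.Vec.Base using (Vec; count; toList)
open import Relation.Binary.PropositionalEquality
  using (_≡_; refl; sym; trans; cong; cong₂; subst; subst₂)
open import Relation.Nullary.Decidable using (_×-dec_)

∣p∣≤r : ∀ {p r} → p ≤ r → - p ≤ r → ∣ p ∣ ≤ r
∣p∣≤r {p} {r} p≤r -p≤r with ∣p∣≡p∨∣p∣≡-p p
... | inj₁ eq = subst (_≤ r) (sym eq) p≤r
... | inj₂ eq = subst (_≤ r) (sym eq) -p≤r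

p≤∣p∣ : ∀ p → p ≤ ∣ p ∣
p≤∣p∣ p with ≤-total 0ℚ p
... | inj₁ 0≤p = ≤-reflexive (sym (0≤p⇒∣p∣≡p 0≤p))
... | inj₂ p≤0 = ≤-trans p≤0 (0≤∣p∣ p)

∣p-q∣≡∣q-p∣ : ∀ p q → ∣ p - q ∣ ≡ ∣ q - p ∣
∣p-q∣≡∣q-p∣ p q = trans (cong ∣_∣ (solve 2 (λ p q → p :- q := :- (q :- p)) refl p q))
                       (∣-p∣≡∣p∣ (q - p))
  where open +-*-Solver

0≤p*q : ∀ p q → 0ℚ ≤ p → 0ℚ ≤ q → 0ℚ ≤ p * q
0≤p*q p q 0≤p 0≤q = subst (_≤ p * q) (*-zeroʳ p)
  (*-monoˡ-≤-nonNeg p {{nonNegative 0≤p}} 0≤q)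

0<p*q : ∀ p q → 0ℚ < p → 0ℚ < q → 0ℚ < p * q
0<p*q p q 0<p 0<q = subst (_< p * q) (*-zeroʳ p)
  (*-monoʳ-<-pos p {{positive 0<p}} 0<q)

*-mono-≤ : ∀ {p q r s} → 0ℚ ≤ p → 0ℚ ≤ s → p ≤ q → r ≤ s → p * r ≤ q * s
*-mono-≤ {p} {s = s} 0≤p 0≤s p≤q r≤s = ≤-trans
  (*-monoˡ-≤-nonNeg p {{nonNegative 0≤p}} r≤s)
  (*-monoʳ-≤-nonNeg s {{nonNegative 0≤s}} p≤q)

p-q≤r⇒p≤q+r : ∀ {p q r} → p - q ≤ r → p ≤ q + r
p-q≤r⇒p≤q+r {p} {q} p-q≤r =
  subst (_≤ _) (solve 2 (λ p q → q :+ (p :- q) := p) refl p q) (+-monoʳ-≤ q p-q≤r)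
  where open +-*-Solver

p≤q+r⇒p-q≤r : ∀ {p q r} → p ≤ q + r → p - q ≤ r
p≤q+r⇒p-q≤r {p} {q} {r} p≤q+r =
  subst (_ ≤_) (solve 2 (λ q r → q :+ r :- q := r) refl q r) (+-monoˡ-≤ (- q) p≤q+r)
  where open +-*-Solver

0<½ : 0ℚ < ½
0<½ = positive⁻¹ ½

0≤1 : 0ℚ ≤ 1ℚ
0≤1 = nonNegative⁻¹ 1ℚ

½p+½p≡p : ∀ p → ½ * p + ½ * p ≡ p
½p+½p≡p p = trans (sym (*-distribʳ-+ p ½ ½)) (*-identityˡ p)

recip : ∀ q → 0ℚ < q → ℚ
recip q 0<q = (1/ q) {{pos⇒nonZero q {{positive 0<q}}}}

recip-pos : ∀ q (0<q : 0ℚ < q) → 0ℚ < recip q 0<q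
recip-pos q 0<q = positive⁻¹ _ {{1/pos⇒pos q {{positive 0<q}}}}

recip-inverseʳ : ∀ q (0<q : 0ℚ < q) → q * recip q 0<q ≡ 1ℚ
recip-inverseʳ q 0<q = *-inverseʳ q {{pos⇒nonZero q {{positive 0<q}}}}

recip-antimono : ∀ {p q} (0<p : 0ℚ < p) (0<q : 0ℚ < q) → p ≤ q → recip q 0<q ≤ recip p 0<p
recip-antimono {p} {q} 0<p 0<q p≤q = *-cancelˡ-≤-pos p {{positive 0<p}} (begin
  p * recip q 0<q  ≤⟨ *-monoʳ-≤-nonNeg _ {{nonNegative (<⇒≤ (recip-pos q 0<q))}} p≤q ⟩
  q * recip q 0<q  ≡⟨ recip-inverseʳ q 0<q ⟩
  1ℚ               ≡⟨ recip-inverseʳ p 0<p ⟨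
  p * recip p 0<p  ∎)
  where open ≤-Reasoning

Cauchy : (ℕ → ℚ) → Set
Cauchy x = ∀ e → 0ℚ < e → ∃[ N ] (∀ m n → N ℕ.≤ m → N ℕ.≤ n → ∣ x m - x n ∣ ≤ e)

record ℝ : Set where
  constructor mkℝ
  field
    seq    : ℕ → ℚ
    cauchy : Cauchy seq

open ℝ public

infix 4 _≤ᴿ_ _<ᴿ_

-- The order of the real numbers, not the termwise order of the sequences.

_≤ᴿ_ : ℝ → ℝ → Set
x ≤ᴿ y = ∀ e → 0ℚ < e → ∃[ N ] (∀ n → N ℕ.≤ n → seq x n ≤ seq y n + e)

_<ᴿ_ : ℝ → ℝ → Set
x <ᴿ y = Σ[ δ ∈ ℚ ] (0ℚ < δ × ∃[ N ] (∀ n → N ℕ.≤ n → seq x n + δ ≤ seq y n))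

termwise-≤ : ∀ {x y} → (∀ n → seq x n ≤ seq y n) → x ≤ᴿ y
termwise-≤ {x} {y} x≤y e 0<e = 0 , λ n _ → ≤-trans (x≤y n)
  (subst (_≤ seq y n + e) (+-identityʳ (seq y n)) (+-monoʳ-≤ (seq y n) (<⇒≤ 0<e)))

fromℚ : ℚ → ℝ
fromℚ q = mkℝ (λ _ → q) λ e 0<e → 0 , λ _ _ _ _ →
  subst (λ z → ∣ z ∣ ≤ e) (sym (+-inverseʳ q)) (<⇒≤ 0<e)

fromℕ : ℕ → ℝ
fromℕ n = fromℚ (+ n / 1)

0ᴿ 1ᴿ : ℝ
0ᴿ = fromℚ 0ℚ
1ᴿ = fromℚ 1ℚ

Lipschitz₂ : (ℚ → ℚ → ℚ) → Set
Lipschitz₂ f = ∀ p q r s → ∣ f p q - f r s ∣ ≤ ∣ p - r ∣ + ∣ q - s ∣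

lipschitz₂-cauchy : ∀ f → Lipschitz₂ f → (x y : ℝ) → Cauchy (λ n → f (seq x n) (seq y n))
lipschitz₂-cauchy f lip x y e 0<e
  with cauchy x (½ * e) (0<p*q ½ e 0<½ 0<e) | cauchy y (½ * e) (0<p*q ½ e 0<½ 0<e)
... | M , hx | N , hy = M ℕ.⊔ N , λ m n Km Kn → ≤-trans
  (lip (seq x m) (seq y m) (seq x n) (seq y n))
  (subst (_ ≤_) (½p+½p≡p e)
    (+-mono-≤ (hx m n (ℕ.m⊔n≤o⇒m≤o M N Km) (ℕ.m⊔n≤o⇒m≤o M N Kn))
              (hy m n (ℕ.m⊔n≤o⇒n≤o M N Km) (ℕ.m⊔n≤o⇒n≤o M N Kn))))

+-lipschitz : Lipschitz₂ _+_
+-lipschitz p q r s = subst (λ z → ∣ z ∣ ≤ ∣ p - r ∣ + ∣ q - s ∣)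
  (solve 4 (λ p q r s → (p :- r) :+ (q :- s) := (p :+ q) :- (r :+ s)) refl p q r s)
  (∣p+q∣≤∣p∣+∣q∣ (p - r) (q - s))
  where open +-*-Solver

⊓-half : ∀ p q r s → p ⊓ q - r ⊓ s ≤ ∣ p - r ∣ + ∣ q - s ∣
⊓-half p q r s with ⊓-sel r s
... | inj₁ eq = begin
  p ⊓ q - r ⊓ s          ≡⟨ cong (λ z → p ⊓ q - z) eq ⟩
  p ⊓ q - r              ≤⟨ +-monoˡ-≤ (- r) (p⊓q≤p p q) ⟩
  p - r                  ≤⟨ p≤∣p∣ (p - r) ⟩
  ∣ p - r ∣              ≡⟨ +-identityʳ _ ⟨
  ∣ p - r ∣ + 0ℚ         ≤⟨ +-monoʳ-≤ ∣ p - r ∣ (0≤∣p∣ (q - s)) ⟩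
  ∣ p - r ∣ + ∣ q - s ∣  ∎
  where open ≤-Reasoning
... | inj₂ eq = begin
  p ⊓ q - r ⊓ s          ≡⟨ cong (λ z → p ⊓ q - z) eq ⟩
  p ⊓ q - s              ≤⟨ +-monoˡ-≤ (- s) (p⊓q≤q p q) ⟩
  q - s                  ≤⟨ p≤∣p∣ (q - s) ⟩
  ∣ q - s ∣              ≡⟨ +-identityˡ _ ⟨
  0ℚ + ∣ q - s ∣         ≤⟨ +-monoˡ-≤ ∣ q - s ∣ (0≤∣p∣ (p - r)) ⟩
  ∣ p - r ∣ + ∣ q - s ∣  ∎
  where open ≤-Reasoning

⊓-lipschitz : Lipschitz₂ _⊓_
⊓-lipschitz p q r s = ∣p∣≤r (⊓-half p q r s)
  (subst₂ _≤_ (solve 2 (λ a b → b :- a := :- (a :- b)) refl (p ⊓ q) (r ⊓ s))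
    (cong₂ _+_ (∣p-q∣≡∣q-p∣ r p) (∣p-q∣≡∣q-p∣ s q)) (⊓-half r s p q))
  where open +-*-Solver

infixl 6 _+ᴿ_ _-ᴿ_
infixl 7 _*ᴿ_ _⊓ᴿ_

_+ᴿ_ : ℝ → ℝ → ℝ
x +ᴿ y = mkℝ (λ n → seq x n + seq y n) (lipschitz₂-cauchy _+_ +-lipschitz x y)

_⊓ᴿ_ : ℝ → ℝ → ℝ
x ⊓ᴿ y = mkℝ (λ n → seq x n ⊓ seq y n) (lipschitz₂-cauchy _⊓_ ⊓-lipschitz x y)

-ᴿ_ : ℝ → ℝ
-ᴿ x = mkℝ (λ n → - seq x n) λ e 0<e →
  let N , h = cauchy x e 0<e in
  N , λ m n Nm Nn → subst (_≤ e)
    (trans (∣p-q∣≡∣q-p∣ (seq x m) (seq x n))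
           (cong ∣_∣ (solve 2 (λ p q → q :- p := :- p :- (:- q)) refl (seq x m) (seq x n))))
    (h m n Nm Nn)
  where open +-*-Solver

_-ᴿ_ : ℝ → ℝ → ℝ
x -ᴿ y = x +ᴿ (-ᴿ y)

eventually-bounded : (x : ℝ) → Σ[ B ∈ ℚ ] (0ℚ < B × ∃[ N ] (∀ n → N ℕ.≤ n → ∣ seq x n ∣ ≤ B))
eventually-bounded x with cauchy x 1ℚ (positive⁻¹ 1ℚ)
... | N , h = ∣ seq x N ∣ + 1ℚ
            , +-mono-≤-< {0ℚ} {∣ seq x N ∣} {0ℚ} {1ℚ} (0≤∣p∣ (seq x N)) (positive⁻¹ 1ℚ)
            , N , λ n Nn → begin
  ∣ seq x n ∣                            ≡⟨ cong ∣_∣ (solve 2 (λ a b → b := a :+ (b :- a)) refl (seq x N) (seq x n)) ⟩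
  ∣ seq x N + (seq x n - seq x N) ∣      ≤⟨ ∣p+q∣≤∣p∣+∣q∣ (seq x N) (seq x n - seq x N) ⟩
  ∣ seq x N ∣ + ∣ seq x n - seq x N ∣    ≤⟨ +-monoʳ-≤ ∣ seq x N ∣ (h n N Nn ℕ.≤-refl) ⟩
  ∣ seq x N ∣ + 1ℚ                       ∎
  where open ≤-Reasoning
        open +-*-Solver

product-bound : ∀ p q r s {A B h} (0<A : 0ℚ < A) (0<B : 0ℚ < B) → 0ℚ < h →
                ∣ p ∣ ≤ A → ∣ s ∣ ≤ B →
                ∣ p - r ∣ ≤ h * recip B 0<B → ∣ q - s ∣ ≤ h * recip A 0<A →
                ∣ p * q - r * s ∣ ≤ h + h
product-bound p q r s {A} {B} {h} 0<A 0<B 0<h p≤A s≤B p-r≤ q-s≤ = begin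
  ∣ p * q - r * s ∣
    ≡⟨ cong ∣_∣ (split p q r s) ⟩
  ∣ p * (q - s) + (p - r) * s ∣
    ≤⟨ ∣p+q∣≤∣p∣+∣q∣ (p * (q - s)) ((p - r) * s) ⟩
  ∣ p * (q - s) ∣ + ∣ (p - r) * s ∣
    ≡⟨ cong₂ _+_ (∣p*q∣≡∣p∣*∣q∣ p (q - s)) (∣p*q∣≡∣p∣*∣q∣ (p - r) s) ⟩
  ∣ p ∣ * ∣ q - s ∣ + ∣ p - r ∣ * ∣ s ∣
    ≤⟨ +-mono-≤
         (*-mono-≤ {∣ p ∣} {A} {∣ q - s ∣} {h * A⁻¹}
           (0≤∣p∣ p) (<⇒≤ (0<p*q h A⁻¹ 0<h (recip-pos A 0<A))) p≤A q-s≤)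
         (*-mono-≤ {∣ p - r ∣} {h * B⁻¹} {∣ s ∣} {B} (0≤∣p∣ (p - r)) (<⇒≤ 0<B) p-r≤ s≤B) ⟩
  A * (h * A⁻¹) + h * B⁻¹ * B
    ≡⟨ regroup A A⁻¹ B B⁻¹ h ⟩
  (A * A⁻¹) * h + (B * B⁻¹) * h
    ≡⟨ cong₂ (λ a b → a * h + b * h) (recip-inverseʳ A 0<A) (recip-inverseʳ B 0<B) ⟩
  1ℚ * h + 1ℚ * h
    ≡⟨ cong₂ _+_ (*-identityˡ h) (*-identityˡ h) ⟩
  h + h ∎
  where
  open ≤-Reasoning
  open +-*-Solver
  A⁻¹ = recip A 0<A
  B⁻¹ = recip B 0<B
  split : ∀ a b c d → a * b - c * d ≡ a * (b - d) + (a - c) * d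
  split = solve 4 (λ a b c d → a :* b :- c :* d := a :* (b :- d) :+ (a :- c) :* d) refl
  regroup : ∀ a a' b b' h → a * (h * a') + h * b' * b ≡ (a * a') * h + (b * b') * h
  regroup = solve 5
    (λ a a' b b' h → a :* (h :* a') :+ h :* b' :* b := (a :* a') :* h :+ (b :* b') :* h) refl

*-cauchy : ∀ (x y : ℝ) → Cauchy (λ n → seq x n * seq y n)
*-cauchy x y e 0<e =
  let A , 0<A , M₁ , ∣x∣≤A = eventually-bounded x
      B , 0<B , N₁ , ∣y∣≤B = eventually-bounded y
      h   = ½ * e
      0<h = 0<p*q ½ e 0<½ 0<e
      M₂ , hx = cauchy x (h * recip B 0<B) (0<p*q h (recip B 0<B) 0<h (recip-pos B 0<B))
      N₂ , hy = cauchy y (h * recip A 0<A) (0<p*q h (recip A 0<A) 0<h (recip-pos A 0<A))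
      M = M₁ ℕ.⊔ M₂
      N = N₁ ℕ.⊔ N₂
  in M ℕ.⊔ N , λ m n Km Kn →
     let Mm = ℕ.m⊔n≤o⇒m≤o M N Km
         Mn = ℕ.m⊔n≤o⇒m≤o M N Kn
         Nm = ℕ.m⊔n≤o⇒n≤o M N Km
         Nn = ℕ.m⊔n≤o⇒n≤o M N Kn
     in subst (∣ seq x m * seq y m - seq x n * seq y n ∣ ≤_) (½p+½p≡p e)
          (product-bound (seq x m) (seq y m) (seq x n) (seq y n) {A} {B} {h} 0<A 0<B 0<h
            (∣x∣≤A m (ℕ.m⊔n≤o⇒m≤o M₁ M₂ Mm))
            (∣y∣≤B n (ℕ.m⊔n≤o⇒m≤o N₁ N₂ Nn))
            (hx m n (ℕ.m⊔n≤o⇒n≤o M₁ M₂ Mm) (ℕ.m⊔n≤o⇒n≤o M₁ M₂ Mn))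
            (hy m n (ℕ.m⊔n≤o⇒n≤o N₁ N₂ Nm) (ℕ.m⊔n≤o⇒n≤o N₁ N₂ Nn)))

_*ᴿ_ : ℝ → ℝ → ℝ
x *ᴿ y = mkℝ (λ n → seq x n * seq y n) (*-cauchy x y)

0<p⊔δ : ∀ p {δ} → 0ℚ < δ → 0ℚ < p ⊔ δ
0<p⊔δ p {δ} 0<δ = <-≤-trans 0<δ (p≤q⊔p p δ)

inverse-half : ∀ {δ p q} (0<δ : 0ℚ < δ) (0<p : 0ℚ < p) (0<q : 0ℚ < q) → δ ≤ p → δ ≤ q →
               recip p 0<p - recip q 0<q ≤ recip δ 0<δ * recip δ 0<δ * ∣ p - q ∣
inverse-half {δ} {p} {q} 0<δ 0<p 0<q δ≤p δ≤q = begin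
  p⁻¹ - q⁻¹
    ≡⟨ cong₂ (λ a b → a - b) (sym (*-identityʳ p⁻¹)) (sym (*-identityʳ q⁻¹)) ⟩
  p⁻¹ * 1ℚ - q⁻¹ * 1ℚ
    ≡⟨ cong₂ (λ a b → p⁻¹ * a - q⁻¹ * b) (sym (recip-inverseʳ q 0<q)) (sym (recip-inverseʳ p 0<p)) ⟩
  p⁻¹ * (q * q⁻¹) - q⁻¹ * (p * p⁻¹)
    ≡⟨ solve 4 (λ p q a b → a :* (q :* b) :- b :* (p :* a) := a :* b :* (q :- p)) refl p q p⁻¹ q⁻¹ ⟩
  p⁻¹ * q⁻¹ * (q - p)
    ≤⟨ *-monoˡ-≤-nonNeg (p⁻¹ * q⁻¹) {{nonNegative 0≤p⁻¹q⁻¹}} (p≤∣p∣ (q - p)) ⟩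
  p⁻¹ * q⁻¹ * ∣ q - p ∣
    ≡⟨ cong (p⁻¹ * q⁻¹ *_) (∣p-q∣≡∣q-p∣ q p) ⟩
  p⁻¹ * q⁻¹ * ∣ p - q ∣
    ≤⟨ *-monoʳ-≤-nonNeg ∣ p - q ∣ {{nonNegative (0≤∣p∣ (p - q))}}
         (*-mono-≤ {p⁻¹} {recip δ 0<δ} {q⁻¹} {recip δ 0<δ} (<⇒≤ (recip-pos p 0<p)) (<⇒≤ (recip-pos δ 0<δ))
           (recip-antimono 0<δ 0<p δ≤p) (recip-antimono 0<δ 0<q δ≤q)) ⟩
  recip δ 0<δ * recip δ 0<δ * ∣ p - q ∣ ∎
  where
  open ≤-Reasoning
  open +-*-Solver
  p⁻¹ = recip p 0<p
  q⁻¹ = recip q 0<q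
  0≤p⁻¹q⁻¹ : 0ℚ ≤ p⁻¹ * q⁻¹
  0≤p⁻¹q⁻¹ = 0≤p*q p⁻¹ q⁻¹ (<⇒≤ (recip-pos p 0<p)) (<⇒≤ (recip-pos q 0<q))

⊔-inverse-cauchy : ∀ (x : ℝ) {δ} (0<δ : 0ℚ < δ) (N : ℕ) → (∀ n → N ℕ.≤ n → δ ≤ seq x n) →
                   Cauchy (λ n → recip (seq x n ⊔ δ) (0<p⊔δ (seq x n) 0<δ))
⊔-inverse-cauchy x {δ} 0<δ N δ≤x e 0<e
  with cauchy x (δ * δ * e) (0<p*q (δ * δ) e (0<p*q δ δ 0<δ 0<δ) 0<e)
... | M , h = M ℕ.⊔ N , λ m n Km Kn →
  let m≥M = ℕ.m⊔n≤o⇒m≤o M N Km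
      n≥M = ℕ.m⊔n≤o⇒m≤o M N Kn
      m≥N = ℕ.m⊔n≤o⇒n≤o M N Km
      n≥N = ℕ.m⊔n≤o⇒n≤o M N Kn
  in ∣p∣≤r (half m n m≥N n≥N (h m n m≥M n≥M))
       (subst (_≤ e)
         (solve 2 (λ a b → b :- a := :- (a :- b)) refl (inv m) (inv n))
         (half n m n≥N m≥N (h n m n≥M m≥M)))
  where
  open +-*-Solver
  δ⁻¹ = recip δ 0<δ
  inv : ℕ → ℚ
  inv n = recip (seq x n ⊔ δ) (0<p⊔δ (seq x n) 0<δ)
  ⊔≡ : ∀ n → N ℕ.≤ n → seq x n ⊔ δ ≡ seq x n
  ⊔≡ n n≥N = p≥q⇒p⊔q≡p (δ≤x n n≥N)
  half : ∀ m n → N ℕ.≤ m → N ℕ.≤ n → ∣ seq x m - seq x n ∣ ≤ δ * δ * e → inv m - inv n ≤ e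
  half m n m≥N n≥N close = begin
    inv m - inv n
      ≤⟨ inverse-half 0<δ (0<p⊔δ (seq x m) 0<δ) (0<p⊔δ (seq x n) 0<δ)
           (p≤q⊔p (seq x m) δ) (p≤q⊔p (seq x n) δ) ⟩
    δ⁻¹ * δ⁻¹ * ∣ (seq x m ⊔ δ) - (seq x n ⊔ δ) ∣
      ≡⟨ cong₂ (λ a b → δ⁻¹ * δ⁻¹ * ∣ a - b ∣) (⊔≡ m m≥N) (⊔≡ n n≥N) ⟩
    δ⁻¹ * δ⁻¹ * ∣ seq x m - seq x n ∣
      ≤⟨ *-monoˡ-≤-nonNeg (δ⁻¹ * δ⁻¹)
           {{nonNegative (0≤p*q δ⁻¹ δ⁻¹ (<⇒≤ (recip-pos δ 0<δ)) (<⇒≤ (recip-pos δ 0<δ)))}} close ⟩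
    δ⁻¹ * δ⁻¹ * (δ * δ * e)
      ≡⟨ solve 3 (λ d i e → i :* i :* (d :* d :* e) := (d :* i) :* (d :* i) :* e) refl δ δ⁻¹ e ⟩
    (δ * δ⁻¹) * (δ * δ⁻¹) * e
      ≡⟨ cong (λ z → z * z * e) (recip-inverseʳ δ 0<δ) ⟩
    1ℚ * 1ℚ * e
      ≡⟨ *-identityˡ e ⟩
    e ∎
    where open ≤-Reasoning

-- The sequence is eventually n ↦ 1/xₙ: the rational δ is the one supplied by
-- 0 < x, so xₙ ⊔ δ = xₙ for large n.

inverse : (x : ℝ) → 0ᴿ <ᴿ x → ℝ
inverse x (δ , 0<δ , N , δ≤x) =
  mkℝ (λ n → recip (seq x n ⊔ δ) (0<p⊔δ (seq x n) 0<δ))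
      (⊔-inverse-cauchy x 0<δ N λ n n≥N → subst (_≤ seq x n) (+-identityˡ δ) (δ≤x n n≥N))

-- Σ_{i=1}^{m} 1/(k+i)
harmonic : ℕ → ℕ → ℚ
harmonic k zero    = 0ℚ
harmonic k (suc m) = harmonic k m + + 1 / suc (k ℕ.+ m)

-- The right Riemann sum of ∫₁ᴰ dt/t with step 1/k, that is
-- Σ_{i=1}^{(D-1)k} (1/k) · 1/(1 + i/k).
logRiemann : ℕ → ℕ → ℚ
logRiemann D k = harmonic k ((D ℕ.∸ 1) ℕ.* k)

unit-≤ : ∀ a b → a ℕ.≤ b → + 1 / suc b ≤ + 1 / suc a
unit-≤ a b a≤b = toℚᵘ-cancel-≤ (begin
  toℚᵘ (+ 1 / suc b)  ≃⟨ toℚᵘ-fromℚᵘ (ℚᵘ.mkℚᵘ (+ 1) b) ⟩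
  ℚᵘ.mkℚᵘ (+ 1) b     ≤⟨ ℚᵘ.*≤* (ℤ.*-monoˡ-≤-nonNeg (+ 1) (ℤ.+≤+ (ℕ.s≤s a≤b))) ⟩
  ℚᵘ.mkℚᵘ (+ 1) a     ≃⟨ toℚᵘ-fromℚᵘ (ℚᵘ.mkℚᵘ (+ 1) a) ⟨
  toℚᵘ (+ 1 / suc a)  ∎)
  where open ℚᵘ.≤-Reasoning

0<unit : ∀ a → 0ℚ < + 1 / suc a
0<unit a = positive⁻¹ _ {{normalize-pos 1 (suc a)}}

0≤harmonic : ∀ k m → 0ℚ ≤ harmonic k m
0≤harmonic k zero    = ≤-refl
0≤harmonic k (suc m) = +-mono-≤ {0ℚ} {harmonic k m} (0≤harmonic k m) (<⇒≤ (0<unit (k ℕ.+ m)))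

harmonic-+ : ∀ k m j → harmonic k (m ℕ.+ j) ≡ harmonic k m + harmonic (k ℕ.+ m) j
harmonic-+ k m zero    = trans (cong (harmonic k) (ℕ.+-identityʳ m)) (sym (+-identityʳ _))
harmonic-+ k m (suc j) rewrite ℕ.+-suc m j | harmonic-+ k m j | sym (ℕ.+-assoc k m j) =
  +-assoc (harmonic k m) (harmonic (k ℕ.+ m) j) _

harmonic-shift : ∀ k m → harmonic k (suc m) ≡ + 1 / suc k + harmonic (suc k) m
harmonic-shift k zero rewrite ℕ.+-identityʳ k = +-comm 0ℚ (+ 1 / suc k)
harmonic-shift k (suc m) rewrite ℕ.+-suc k m | harmonic-shift k m =
  +-assoc (+ 1 / suc k) (harmonic (suc k) m) _

times : ℕ → ℚ → ℚ
times zero    q = 0ℚ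
times (suc j) q = times j q + q

times-unit : ∀ d k → times (suc d) (+ 1 / (suc d ℕ.* suc k)) ≡ + 1 / suc k
times-unit d k = trans (times≡ (suc d)) (cancel d k)
  where
  unit = + 1 / (suc d ℕ.* suc k)
  open +-*-Solver using (solve; con; _:*_; _:+_; _:=_)
  suc≡ : ∀ j → + suc j / 1 ≡ + j / 1 + 1ℚ
  suc≡ j = toℚᵘ-injective (begin
    toℚᵘ (+ suc j / 1)           ≈⟨ toℚᵘ-fromℚᵘ (ℚᵘ.mkℚᵘ (+ suc j) 0) ⟩
    ℚᵘ.mkℚᵘ (+ suc j) 0          ≈⟨ ℚᵘ.*≡* (eq (+ j)) ⟩
    ℚᵘ.mkℚᵘ (+ j) 0 ℚᵘ.+ ℚᵘ.1ℚᵘ  ≈⟨ ℚᵘ.+-congˡ ℚᵘ.1ℚᵘ (toℚᵘ-fromℚᵘ (ℚᵘ.mkℚᵘ (+ j) 0)) ⟨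
    toℚᵘ (+ j / 1) ℚᵘ.+ ℚᵘ.1ℚᵘ   ≈⟨ toℚᵘ-homo-+ (+ j / 1) 1ℚ ⟨
    toℚᵘ (+ j / 1 + 1ℚ)          ∎)
    where
    open import Relation.Binary.Reasoning.Setoid ℚᵘ.≃-setoid
    eq : ∀ j → (+ 1 ℤ.+ j) ℤ.* (+ 1 ℤ.* + 1) ≡ (j ℤ.* + 1 ℤ.+ + 1 ℤ.* + 1) ℤ.* + 1
    eq = ℤ-solve-∀
  times≡ : ∀ j → times j unit ≡ + j / 1 * unit
  times≡ zero    = sym (*-zeroˡ unit)
  times≡ (suc j) rewrite times≡ j | suc≡ j =
    solve 2 (λ a u → a :* u :+ u := (a :+ con 1ℚ) :* u) refl (+ j / 1) unit
  cancel : ∀ d k → + suc d / 1 * (+ 1 / (suc d ℕ.* suc k)) ≡ + 1 / suc k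
  cancel d k = toℚᵘ-injective (begin
    toℚᵘ (+ suc d / 1 * (+ 1 / (suc d ℕ.* suc k)))
      ≈⟨ toℚᵘ-homo-* (+ suc d / 1) (+ 1 / (suc d ℕ.* suc k)) ⟩
    toℚᵘ (+ suc d / 1) ℚᵘ.* toℚᵘ (+ 1 / (suc d ℕ.* suc k))
      ≈⟨ ℚᵘ.*-cong (toℚᵘ-fromℚᵘ (ℚᵘ.mkℚᵘ (+ suc d) 0)) (toℚᵘ-fromℚᵘ (ℚᵘ.mkℚᵘ (+ 1) (k ℕ.+ d ℕ.* suc k))) ⟩
    ℚᵘ.mkℚᵘ (+ suc d) 0 ℚᵘ.* ℚᵘ.mkℚᵘ (+ 1) (k ℕ.+ d ℕ.* suc k)
      ≈⟨ ℚᵘ.*≡* (cong +_ (eq d k)) ⟩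
    ℚᵘ.mkℚᵘ (+ 1) k
      ≈⟨ toℚᵘ-fromℚᵘ (ℚᵘ.mkℚᵘ (+ 1) k) ⟨
    toℚᵘ (+ 1 / suc k) ∎)
    where
    open import Relation.Binary.Reasoning.Setoid ℚᵘ.≃-setoid
    eq : ∀ d k → suc d ℕ.* 1 ℕ.* suc k ≡ 1 ℕ.* (1 ℕ.* (suc d ℕ.* suc k))
    eq = solve-∀

harmonic-≥ : ∀ k j b → (∀ i → i ℕ.< j → k ℕ.+ i ℕ.≤ b) → times j (+ 1 / suc b) ≤ harmonic k j
harmonic-≥ k zero    b h = ≤-refl
harmonic-≥ k (suc j) b h = +-mono-≤ {times j (+ 1 / suc b)}
  (harmonic-≥ k j b λ i i<j → h i (ℕ.m<n⇒m<1+n i<j)) (unit-≤ (k ℕ.+ j) b (h j ℕ.≤-refl))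

harmonic-≤ : ∀ a j → harmonic (suc a) j ≤ times j (+ 1 / suc a)
harmonic-≤ a zero    = ≤-refl
harmonic-≤ a (suc j) = +-mono-≤ {harmonic (suc a) j} {times j (+ 1 / suc a)}
  (harmonic-≤ a j) (unit-≤ a (suc a ℕ.+ j) (ℕ.≤-trans (ℕ.n≤1+n a) (ℕ.m≤m+n (suc a) j)))

module _ (d : ℕ) where

  private
    a : ℕ → ℚ
    a k = harmonic (suc k) (d ℕ.* suc k)

    block : ℕ → ℚ
    block k = harmonic (suc d ℕ.* suc k) (suc d)

    step : ∀ k → + 1 / suc (suc k) + a (suc k) ≡ a k + block k
    step k = trans (sym (harmonic-shift (suc k) (d ℕ.* suc (suc k))))
      (trans (cong (harmonic (suc k)) (eq d k)) (harmonic-+ (suc k) (d ℕ.* suc k) (suc d)))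
      where
      eq : ∀ d k → suc (d ℕ.* suc (suc k)) ≡ d ℕ.* suc k ℕ.+ suc d
      eq = solve-∀

    block-≥ : ∀ k → + 1 / suc (suc k) ≤ block k
    block-≥ k = subst (_≤ block k) (times-unit d (suc k))
      (harmonic-≥ (suc d ℕ.* suc k) (suc d) (suc k ℕ.+ d ℕ.* suc (suc k)) bound)
      where
      eq : ∀ d k → suc d ℕ.* suc k ℕ.+ d ≡ suc k ℕ.+ d ℕ.* suc (suc k)
      eq = solve-∀
      bound : ∀ i → i ℕ.< suc d → suc d ℕ.* suc k ℕ.+ i ℕ.≤ suc k ℕ.+ d ℕ.* suc (suc k)
      bound i (ℕ.s≤s i≤d) = subst (suc d ℕ.* suc k ℕ.+ i ℕ.≤_) (eq d k)
        (ℕ.+-monoʳ-≤ (suc d ℕ.* suc k) i≤d)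

    block-≤ : ∀ k → block k ≤ + 1 / suc k
    block-≤ k = subst (block k ≤_) (times-unit d k) (harmonic-≤ (k ℕ.+ d ℕ.* suc k) (suc d))

    increasing : ∀ k → a k ≤ a (suc k)
    increasing k = begin
      a k                  ≡⟨ solve 2 (λ u x → x := x :+ u :- u) refl u (a k) ⟩
      a k + u - u          ≤⟨ +-monoˡ-≤ (- u) (+-monoʳ-≤ (a k) (block-≥ k)) ⟩
      a k + block k - u    ≡⟨ cong (_- u) (step k) ⟨
      u + a (suc k) - u    ≡⟨ solve 2 (λ u x → u :+ x :- u := x) refl u (a (suc k)) ⟩
      a (suc k)            ∎
      where
      open ≤-Reasoning
      open +-*-Solver
      u = + 1 / suc (suc k)

    decreasing : ∀ k → a (suc k) + + 1 / suc (suc k) ≤ a k + + 1 / suc k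
    decreasing k = begin
      a (suc k) + + 1 / suc (suc k)  ≡⟨ +-comm (a (suc k)) _ ⟩
      + 1 / suc (suc k) + a (suc k)  ≡⟨ step k ⟩
      a k + block k                  ≤⟨ +-monoʳ-≤ (a k) (block-≤ k) ⟩
      a k + + 1 / suc k              ∎
      where open ≤-Reasoning

    increasing* : ∀ k j → a k ≤ a (j ℕ.+ k)
    increasing* k zero    = ≤-refl
    increasing* k (suc j) = ≤-trans (increasing* k j) (increasing (j ℕ.+ k))

    decreasing* : ∀ k j → a (j ℕ.+ k) + + 1 / suc (j ℕ.+ k) ≤ a k + + 1 / suc k
    decreasing* k zero    = ≤-refl
    decreasing* k (suc j) = ≤-trans (decreasing (j ℕ.+ k)) (decreasing* k j)

    upper : ∀ N n → N ℕ.≤ n → a n ≤ a N + + 1 / suc N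
    upper N n N≤n = subst (λ z → a z ≤ a N + + 1 / suc N) (ℕ.m∸n+n≡m N≤n)
      (≤-trans (subst (_≤ a m + + 1 / suc m) (+-identityʳ (a m))
                 (+-monoʳ-≤ (a m) (<⇒≤ (0<unit m))))
               (decreasing* N (n ℕ.∸ N)))
      where m = n ℕ.∸ N ℕ.+ N

    lower : ∀ N n → N ℕ.≤ n → a N ≤ a n
    lower N n N≤n = subst (λ z → a N ≤ a z) (ℕ.m∸n+n≡m N≤n) (increasing* N (n ℕ.∸ N))

    close : ∀ N m n → N ℕ.≤ m → N ℕ.≤ n → a m - a n ≤ + 1 / suc N
    close N m n N≤m N≤n = p≤q+r⇒p-q≤r {a m} {a n}
      (≤-trans (upper N m N≤m) (+-monoˡ-≤ (+ 1 / suc N) (lower N n N≤n)))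

    archimedean : ∀ e → 0ℚ < e → + 1 / ↧ₙ e ≤ e
    archimedean e 0<e = archimedean⁺ e {{positive 0<e}}
      where
      archimedean⁺ : ∀ e → .{{Positive e}} → + 1 / ↧ₙ e ≤ e
      archimedean⁺ (mkℚ (+ suc n) b c) = toℚᵘ-cancel-≤ (begin
        toℚᵘ (+ 1 / suc b)    ≃⟨ toℚᵘ-fromℚᵘ (ℚᵘ.mkℚᵘ (+ 1) b) ⟩
        ℚᵘ.mkℚᵘ (+ 1) b       ≤⟨ ℚᵘ.*≤* (ℤ.*-monoʳ-≤-nonNeg (+ suc b) {+ 1} {+ suc n} (ℤ.+≤+ (ℕ.s≤s ℕ.z≤n))) ⟩
        ℚᵘ.mkℚᵘ (+ suc n) b   ∎)
        where open ℚᵘ.≤-Reasoning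

  logRiemann-cauchy : Cauchy (λ k → harmonic (suc k) (d ℕ.* suc k))
  logRiemann-cauchy e 0<e = ℚ.denominator-1 e , λ m n N≤m N≤n →
    ≤-trans
      (∣p∣≤r (close _ m n N≤m N≤n)
        (subst (_≤ + 1 / ↧ₙ e) (solve 2 (λ x y → y :- x := :- (x :- y)) refl (a m) (a n))
          (close _ n m N≤n N≤m)))
      (archimedean e 0<e)
    where open +-*-Solver

log : ℕ → ℝ
log D = mkℝ (λ n → logRiemann D (suc n)) (logRiemann-cauchy (D ℕ.∸ 1))

-- A list of weighted outcomes. The weights of the distributions built from
-- return, _>>=_ and bernoulli are nonnegative and sum to 1.
Dist : Set → Set
Dist A = List (ℝ × A)

Probability : Set
Probability = Σ[ q ∈ ℝ ] (0ᴿ ≤ᴿ q × q ≤ᴿ 1ᴿ)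

return : ∀ {A} → A → Dist A
return x = (1ᴿ , x) ∷ []

infixl 1 _>>=_

_>>=_ : ∀ {A B} → Dist A → (A → Dist B) → Dist B
μ >>= f = List.concatMap (λ (q , x) → List.map (λ (r , y) → q *ᴿ r , y) (f x)) μ

bernoulli : Probability → Dist Bool
bernoulli (q , _) = (q , true) ∷ (1ᴿ -ᴿ q , false) ∷ []

sumᴿ : List ℝ → ℝ
sumᴿ = List.foldr _+ᴿ_ 0ᴿ

expectation : ∀ {A} → (A → ℝ) → Dist A → ℝ
expectation X μ = sumᴿ (List.map (λ (q , x) → q *ᴿ X x) μ)

-- The outcomes are weighted by products: the f x are independent of one another.
concatMapᴰ : ∀ {A B : Set} → (A → Dist (List B)) → List A → Dist (List B)
concatMapᴰ f []       = return []
concatMapᴰ f (x ∷ xs) = f x >>= λ ys → concatMapᴰ f xs >>= λ zs → return (ys ++ zs)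

-- Only membership of words in a document matters, so a document is the set of
-- its distinct words.
Document : ℕ → Set
Document D = Subset D

#_within_ : ∀ {D N} → Fin D → Vec (Document D) N → ℕ
# w within T = count (w ∈?_) T

-- An unordered pair of distinct words is represented by its increasing ordering.
wordPairs : ∀ {D} → Document D → List (Fin D × Fin D)
wordPairs {D} t = filter
  (λ (v , w) → v <ᶠ? w ×-dec v ∈? t ×-dec w ∈? t)
  (cartesianProduct (allFin D) (allFin D))

-- Only applied to positive numbers by the mapper: a word of some document of T
-- has a positive count.
reciprocal : ℕ → ℚ
reciprocal zero    = 0ℚ
reciprocal (suc n) = + 1 / suc n

0≤reciprocal : ∀ n → 0ℚ ≤ reciprocal n
0≤reciprocal zero    = ≤-refl
0≤reciprocal (suc n) = <⇒≤ (0<unit n)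

oversampling : ℕ → ℝ
oversampling D = fromℕ 2 *ᴿ log D

module _ {D N : ℕ} (T : Vec (Document D) N) (ε : ℝ) (0<ε : 0ᴿ <ᴿ ε) where

  emitProbability : Fin D → Fin D → Probability
  emitProbability v w =
      1ᴿ ⊓ᴿ q
    , termwise-≤ {0ᴿ} {1ᴿ ⊓ᴿ q} 0≤
    , termwise-≤ {1ᴿ ⊓ᴿ q} {1ᴿ} (λ n → p⊓q≤p 1ℚ (seq q n))
    where
    q : ℝ
    q = oversampling D *ᴿ inverse ε 0<ε *ᴿ fromℚ (reciprocal (# v within T ℕ.⊓ # w within T))
    0≤ : ∀ n → 0ℚ ≤ 1ℚ ⊓ seq q n
    0≤ n = ⊓-glb 0≤1 (0≤p*q (seq (oversampling D *ᴿ inverse ε 0<ε) n) _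
      (0≤p*q (seq (oversampling D) n) (seq (inverse ε 0<ε) n)
        (0≤p*q (+ 2 / 1) (seq (log D) n) (nonNegative⁻¹ (+ 2 / 1)) (0≤harmonic (suc n) ((D ℕ.∸ 1) ℕ.* suc n)))
        (<⇒≤ (recip-pos (seq ε n ⊔ proj₁ 0<ε) (0<p⊔δ (seq ε n) (proj₁ (proj₂ 0<ε))))))
      (0≤reciprocal (# v within T ℕ.⊓ # w within T)))

  KeyValue : Set
  KeyValue = (Fin D × Fin D) × ℕ

  emitPair : Fin D × Fin D → Dist (List KeyValue)
  emitPair (v , w) = bernoulli (emitProbability v w) >>= λ heads →
    return (if heads then ((v , w) , 1) ∷ [] else [])

  overlapSampleEmit : Document D → Dist (List KeyValue)
  overlapSampleEmit t = concatMapᴰ emitPair (wordPairs t)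

  mapPhase : Dist (List KeyValue)
  mapPhase = concatMapᴰ overlapSampleEmit (toList T)

  expectedShuffleSize : ℝ
  expectedShuffleSize = expectation (λ emitted → fromℕ (length emitted)) mapPhase

{-# OPTIONS --safe #-}

-- All operations on ℝ act termwise on the approximating sequences, so it suffices
-- to bound the n-th approximation of the expectation, a finite rational sum.
-- Its weights have total 1, hence by linearity it is the sum of the emission
-- probabilities over all documents t and all pairs of words v, w of t. With
-- c = 2 log D / ε, such a probability is at most
-- c / min(#v, #w) ≤ c (1/#v + 1/#w), and summing over all ordered pairs gives
-- at most 2c Σ_t |t| Σ_{v ∈ t} 1/#v ≤ 2cL Σ_v Σ_{t ∋ v} 1/#v ≤ 2cLD.

module Submission where

open import Defs
open import Data.Bool.Base using (Bool; true; false; _∧_; if_then_else_)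
open import Data.Fin.Base using (Fin; zero; suc)
open import Data.Fin.Properties using () renaming (_<?_ to _<ᶠ?_)
open import Data.Fin.Subset using (∣_∣)
open import Data.Fin.Subset.Properties using (_∈?_)
open import Data.Integer.Base as ℤ using (+_)
import Data.Integer.Tactic.RingSolver as ℤ-Solver
open import Data.List.Base as List
  using (List; []; _∷_; _++_; length; filter; cartesianProduct; allFin)
import Data.List.Properties as List
import Data.List.Relation.Unary.All as ListAll
open import Data.Nat.Base using (ℕ; _≤_; _*_)
import Data.Nat.Base as ℕ
import Data.Nat.Properties as ℕ
open import Data.Product.Base using (Σ-syntax; _×_; _,_; proj₁; proj₂)
open import Data.Rational.Base as ℚ using (ℚ; 0ℚ; 1ℚ; _+_; _/_; _⊓_; toℚᵘ; nonNegative)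
open import Data.Rational.Properties
open import Data.Rational.Solver using (module +-*-Solver)
import Data.Rational.Unnormalised.Base as ℚᵘ
import Data.Rational.Unnormalised.Properties as ℚᵘ
open import Data.Sum.Base using (inj₁; inj₂)
open import Data.Vec.Base using (Vec; []; _∷_; toList)
open import Data.Vec.Relation.Unary.All using (All)
import Data.Vec.Relation.Unary.All.Properties as All
open import Function.Base using (_∘_; id)
open import Relation.Binary.PropositionalEquality
  using (_≡_; refl; sym; trans; cong; cong₂; subst; module ≡-Reasoning)
open import Relation.Nullary.Decidable using (does)
open import Relation.Unary using (Pred; Decidable)
import Relation.Binary.Reasoning.Setoid ℚᵘ.≃-setoid as ≃-Reasoning
open +-*-Solver using (solve; con; _:+_; _:*_; _:=_; :-_)

private
  variable
    A B : Set

-- Natural numbers as rationals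

-- The constant term of `fromℕ`: `seq (fromℕ k) n` reduces to `ι k`.
ι : ℕ → ℚ
ι n = + n / 1

-- Since `_/_` divides by a gcd, it does not reduce on variables. In the unnormalised rationals the
-- claim becomes a ring identity over the integers.
ι-+ : ∀ m n → ι (m ℕ.+ n) ≡ ι m + ι n
ι-+ m n = toℚᵘ-injective (begin
  toℚᵘ (ι (m ℕ.+ n))                       ≈⟨ toℚᵘ-fromℚᵘ (ℚᵘ.mkℚᵘ (+ (m ℕ.+ n)) 0) ⟩
  ℚᵘ.mkℚᵘ (+ m ℤ.+ + n) 0                  ≈⟨ ℚᵘ.*≡* (eq (+ m) (+ n)) ⟩
  ℚᵘ.mkℚᵘ (+ m) 0 ℚᵘ.+ ℚᵘ.mkℚᵘ (+ n) 0     ≈⟨ ℚᵘ.+-cong (toℚᵘ-fromℚᵘ (ℚᵘ.mkℚᵘ (+ m) 0)) (toℚᵘ-fromℚᵘ (ℚᵘ.mkℚᵘ (+ n) 0)) ⟨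
  toℚᵘ (ι m) ℚᵘ.+ toℚᵘ (ι n)               ≈⟨ toℚᵘ-homo-+ (ι m) (ι n) ⟨
  toℚᵘ (ι m + ι n)                         ∎)
  where
  open ≃-Reasoning
  eq : ∀ i j → (i ℤ.+ j) ℤ.* (+ 1 ℤ.* + 1) ≡ (i ℤ.* + 1 ℤ.+ j ℤ.* + 1) ℤ.* + 1
  eq = ℤ-Solver.solve-∀

ι-* : ∀ m n → ι (m * n) ≡ ι m ℚ.* ι n
ι-* ℕ.zero    n = sym (*-zeroˡ (ι n))
ι-* (ℕ.suc m) n = begin
  ι (n ℕ.+ m * n)            ≡⟨ ι-+ n (m * n) ⟩
  ι n + ι (m * n)            ≡⟨ cong (λ z → ι n + z) (ι-* m n) ⟩
  ι n + ι m ℚ.* ι n          ≡⟨ solve 2 (λ a b → b :+ a :* b := (con 1ℚ :+ a) :* b) refl (ι m) (ι n) ⟩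
  (1ℚ + ι m) ℚ.* ι n         ≡⟨ cong (ℚ._* ι n) (ι-+ 1 m) ⟨
  ι (ℕ.suc m) ℚ.* ι n        ∎
  where open ≡-Reasoning

0≤ι : ∀ n → 0ℚ ℚ.≤ ι n
0≤ι n = nonNegative⁻¹ (ι n) {{normalize-nonNeg n 1}}

ι-mono : ∀ {m n} → m ≤ n → ι m ℚ.≤ ι n
ι-mono {m} {n} m≤n = begin
  ι m                    ≡⟨ +-identityʳ (ι m) ⟨
  ι m + 0ℚ               ≤⟨ +-monoʳ-≤ (ι m) (0≤ι (n ℕ.∸ m)) ⟩
  ι m + ι (n ℕ.∸ m)      ≡⟨ ι-+ m (n ℕ.∸ m) ⟨
  ι (m ℕ.+ (n ℕ.∸ m))    ≡⟨ cong ι (ℕ.m+[n∸m]≡n m≤n) ⟩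
  ι n                    ∎
  where open ≤-Reasoning

-- An inequality, since reciprocal 0 = 0.
reciprocal-*-≤1 : ∀ n → reciprocal n ℚ.* ι n ℚ.≤ 1ℚ
reciprocal-*-≤1 ℕ.zero    = 0≤1
reciprocal-*-≤1 (ℕ.suc n) = ≤-reflexive (toℚᵘ-injective (begin
  toℚᵘ (+ 1 / ℕ.suc n ℚ.* ι (ℕ.suc n))             ≈⟨ toℚᵘ-homo-* (+ 1 / ℕ.suc n) (ι (ℕ.suc n)) ⟩
  toℚᵘ (+ 1 / ℕ.suc n) ℚᵘ.* toℚᵘ (ι (ℕ.suc n))     ≈⟨ ℚᵘ.*-cong (toℚᵘ-fromℚᵘ (ℚᵘ.mkℚᵘ (+ 1) n)) (toℚᵘ-fromℚᵘ (ℚᵘ.mkℚᵘ (+ ℕ.suc n) 0)) ⟩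
  ℚᵘ.mkℚᵘ (+ 1) n ℚᵘ.* ℚᵘ.mkℚᵘ (+ ℕ.suc n) 0       ≈⟨ ℚᵘ.*≡* (eq (+ ℕ.suc n)) ⟩
  ℚᵘ.1ℚᵘ                                           ∎))
  where
  open ≃-Reasoning
  eq : ∀ i → (+ 1 ℤ.* i) ℤ.* + 1 ≡ + 1 ℤ.* (i ℤ.* + 1)
  eq = ℤ-Solver.solve-∀

-- The minimum is one of the two numbers, and the other reciprocal is nonnegative. The sum separates
-- the two words of a pair, which the minimum does not.
reciprocal-⊓ : ∀ m n → reciprocal (m ℕ.⊓ n) ℚ.≤ reciprocal m + reciprocal n
reciprocal-⊓ m n with ℕ.⊓-sel m n
... | inj₁ eq rewrite eq = subst (ℚ._≤ reciprocal m + reciprocal n) (+-identityʳ _)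
                             (+-monoʳ-≤ (reciprocal m) (0≤reciprocal n))
... | inj₂ eq rewrite eq = subst (ℚ._≤ reciprocal m + reciprocal n) (+-identityˡ _)
                             (+-monoˡ-≤ (reciprocal n) (0≤reciprocal m))

-- Finite sums

∑ : (A → ℚ) → List A → ℚ
∑ f []       = 0ℚ
∑ f (x ∷ xs) = f x + ∑ f xs

∑-cong : {f g : A → ℚ} → (∀ x → f x ≡ g x) → ∀ xs → ∑ f xs ≡ ∑ g xs
∑-cong f≗g []       = refl
∑-cong f≗g (x ∷ xs) = cong₂ _+_ (f≗g x) (∑-cong f≗g xs)

-- The bound is assumed only on members of the list because the length bound `L` is known only for
-- the documents of `T`.
∑-mono-All : {f g : A → ℚ} {xs : List A} → ListAll.All (λ x → f x ℚ.≤ g x) xs → ∑ f xs ℚ.≤ ∑ g xs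
∑-mono-All ListAll.[]            = ≤-refl
∑-mono-All (fx≤gx ListAll.∷ f≤g) = +-mono-≤ fx≤gx (∑-mono-All f≤g)

∑-mono : {f g : A → ℚ} → (∀ x → f x ℚ.≤ g x) → ∀ xs → ∑ f xs ℚ.≤ ∑ g xs
∑-mono f≤g xs = ∑-mono-All (ListAll.universal f≤g xs)

∑-zero : (xs : List A) → ∑ (λ _ → 0ℚ) xs ≡ 0ℚ
∑-zero []       = refl
∑-zero (x ∷ xs) = trans (+-identityˡ _) (∑-zero xs)

∑-one : (xs : List A) → ∑ (λ _ → 1ℚ) xs ≡ ι (length xs)
∑-one []       = refl
∑-one (x ∷ xs) = trans (cong (λ z → 1ℚ + z) (∑-one xs)) (sym (ι-+ 1 (length xs)))

∑-+ : (f g : A → ℚ) → ∀ xs → ∑ (λ x → f x + g x) xs ≡ ∑ f xs + ∑ g xs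
∑-+ f g []       = refl
∑-+ f g (x ∷ xs) = trans (cong (λ z → f x + g x + z) (∑-+ f g xs))
  (solve 4 (λ a b c d → a :+ b :+ (c :+ d) := a :+ c :+ (b :+ d)) refl (f x) (g x) (∑ f xs) (∑ g xs))

∑-*ˡ : ∀ c (f : A → ℚ) xs → ∑ (λ x → c ℚ.* f x) xs ≡ c ℚ.* ∑ f xs
∑-*ˡ c f []       = sym (*-zeroʳ c)
∑-*ˡ c f (x ∷ xs) = trans (cong (λ z → c ℚ.* f x + z) (∑-*ˡ c f xs)) (sym (*-distribˡ-+ c (f x) (∑ f xs)))

∑-*ʳ : ∀ c (f : A → ℚ) xs → ∑ (λ x → f x ℚ.* c) xs ≡ ∑ f xs ℚ.* c
∑-*ʳ c f xs = trans (∑-cong (λ x → *-comm (f x) c) xs) (trans (∑-*ˡ c f xs) (*-comm c (∑ f xs)))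

∑-swap : (f : A → B → ℚ) → ∀ xs ys → ∑ (λ x → ∑ (f x) ys) xs ≡ ∑ (λ y → ∑ (λ x → f x y) xs) ys
∑-swap f []       ys = sym (∑-zero ys)
∑-swap f (x ∷ xs) ys = trans (cong (λ z → ∑ (f x) ys + z) (∑-swap f xs ys)) (sym (∑-+ (f x) _ ys))

∑-++ : (f : A → ℚ) → ∀ xs ys → ∑ f (xs ++ ys) ≡ ∑ f xs + ∑ f ys
∑-++ f []       ys = sym (+-identityˡ _)
∑-++ f (x ∷ xs) ys = trans (cong (λ z → f x + z) (∑-++ f xs ys)) (sym (+-assoc (f x) _ _))

∑-map : (f : B → ℚ) (g : A → B) → ∀ xs → ∑ f (List.map g xs) ≡ ∑ (f ∘ g) xs
∑-map f g []       = refl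
∑-map f g (x ∷ xs) = cong (λ z → f (g x) + z) (∑-map f g xs)

∑-cartesianProduct : (f : A × B → ℚ) → ∀ xs ys →
                     ∑ f (cartesianProduct xs ys) ≡ ∑ (λ x → ∑ (λ y → f (x , y)) ys) xs
∑-cartesianProduct f []       ys = refl
∑-cartesianProduct f (x ∷ xs) ys = trans (∑-++ f (List.map (x ,_) ys) _)
  (cong₂ _+_ (∑-map f (x ,_) ys) (∑-cartesianProduct f xs ys))

∑-allFin-suc : ∀ {n} (f : Fin (ℕ.suc n) → ℚ) →
               ∑ f (allFin (ℕ.suc n)) ≡ f zero + ∑ (f ∘ suc) (allFin n)
∑-allFin-suc {n} f = cong (λ z → f zero + z)
  -- The tail of `allFin (suc n)` is `tabulate suc`, which is `map suc (allFin n)`.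
  (trans (cong (∑ f) (sym (List.map-tabulate id suc))) (∑-map f suc (allFin n)))

-- Indicators of Booleans

𝟙 : Bool → ℚ
𝟙 b = if b then 1ℚ else 0ℚ

0≤𝟙 : ∀ b → 0ℚ ℚ.≤ 𝟙 b
0≤𝟙 true  = 0≤1
0≤𝟙 false = ≤-refl

𝟙-∧ : ∀ a b → 𝟙 (a ∧ b) ≡ 𝟙 a ℚ.* 𝟙 b
𝟙-∧ true  b = sym (*-identityˡ (𝟙 b))
𝟙-∧ false b = sym (*-zeroˡ (𝟙 b))

𝟙-∧-≤ʳ : ∀ a b → 𝟙 (a ∧ b) ℚ.≤ 𝟙 b
𝟙-∧-≤ʳ true  b = ≤-refl
𝟙-∧-≤ʳ false b = 0≤𝟙 b

-- Moves the condition from the list into the summand, so that the range of summation is a full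
-- product and the sums can be interchanged and factored.
∑-filter : ∀ {p} {P : Pred A p} (P? : Decidable P) (f : A → ℚ) → ∀ xs →
           ∑ f (filter P? xs) ≡ ∑ (λ x → 𝟙 (does (P? x)) ℚ.* f x) xs
∑-filter P? f []       = refl
∑-filter P? f (x ∷ xs) with does (P? x)
... | true  = cong₂ _+_ (sym (*-identityˡ (f x))) (∑-filter P? f xs)
... | false = trans (∑-filter P? f xs)
                (trans (sym (+-identityˡ _)) (cong (_+ _) (sym (*-zeroˡ (f x)))))

-- Expectations at a fixed index of the approximating sequences

size : List A → ℚ
size xs = ι (length xs)

module _ (n : ℕ) where

  -- Each weight enters through its `n`-th approximation, so the laws of expectation below are
  -- equalities of rationals.
  E : (A → ℚ) → Dist A → ℚ
  E f = ∑ (λ (q , x) → seq q n ℚ.* f x)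

  -- Exact at each index, not only in the limit: the two Bernoulli weights are approximated by
  -- `seq q n` and `1ℚ - seq q n`. Phrased through `E`, it passes through `_>>=_` by `E->>=`.
  Normalised : Dist A → Set
  Normalised μ = E (λ _ → 1ℚ) μ ≡ 1ℚ

  seq-expectation : (X : A → ℝ) → ∀ μ → seq (expectation X μ) n ≡ E (λ x → seq (X x) n) μ
  seq-expectation X []            = refl
  seq-expectation X ((q , x) ∷ μ) = cong (λ z → seq q n ℚ.* seq (X x) n + z) (seq-expectation X μ)

  E-cong : {f g : A → ℚ} → (∀ x → f x ≡ g x) → ∀ μ → E f μ ≡ E g μ
  E-cong f≗g = ∑-cong (λ (q , x) → cong (seq q n ℚ.*_) (f≗g x))

  E-+ : (f g : A → ℚ) → ∀ μ → E (λ x → f x + g x) μ ≡ E f μ + E g μ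
  E-+ f g μ = trans (∑-cong (λ (q , x) → *-distribˡ-+ (seq q n) (f x) (g x)) μ) (∑-+ _ _ μ)

  E-const : ∀ c (μ : Dist A) → Normalised μ → E (λ _ → c) μ ≡ c
  E-const c μ μ-norm = begin
    E (λ _ → c) μ                               ≡⟨ ∑-cong (λ (q , x) → cong (ℚ._* c) (sym (*-identityʳ (seq q n)))) μ ⟩
    ∑ (λ (q , x) → seq q n ℚ.* 1ℚ ℚ.* c) μ      ≡⟨ ∑-*ʳ c (λ (q , x) → seq q n ℚ.* 1ℚ) μ ⟩
    E (λ _ → 1ℚ) μ ℚ.* c                        ≡⟨ cong (ℚ._* c) μ-norm ⟩
    1ℚ ℚ.* c                                    ≡⟨ *-identityˡ c ⟩
    c                                           ∎
    where open ≡-Reasoning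

  E-return : (f : A → ℚ) → ∀ x → E f (return x) ≡ f x
  E-return f x = trans (+-identityʳ _) (*-identityˡ (f x))

  -- The law of total expectation: the weight of each first outcome is a common factor of the block
  -- of outcomes that it generates.
  E->>= : (h : B → ℚ) (μ : Dist A) (f : A → Dist B) → E h (μ >>= f) ≡ E (λ x → E h (f x)) μ
  E->>= h []            f = refl
  E->>= h ((q , x) ∷ μ) f = begin
    E h (List.map (λ (r , y) → q *ᴿ r , y) (f x) ++ (μ >>= f))
      ≡⟨ ∑-++ _ (List.map _ (f x)) (μ >>= f) ⟩
    E h (List.map (λ (r , y) → q *ᴿ r , y) (f x)) + E h (μ >>= f)
      ≡⟨ cong₂ _+_ (∑-map _ _ (f x)) (E->>= h μ f) ⟩
    ∑ (λ (r , y) → seq q n ℚ.* seq r n ℚ.* h y) (f x) + E (λ x → E h (f x)) μ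
      ≡⟨ cong (_+ E (λ x → E h (f x)) μ) (trans
           (∑-cong (λ (r , y) → *-assoc (seq q n) (seq r n) (h y)) (f x))
           (∑-*ˡ (seq q n) _ (f x))) ⟩
    seq q n ℚ.* E h (f x) + E (λ x → E h (f x)) μ ∎
    where open ≡-Reasoning

  >>=-normalised : (μ : Dist A) (f : A → Dist B) → Normalised μ → (∀ x → Normalised (f x)) →
                   Normalised (μ >>= f)
  >>=-normalised μ f μ-norm f-norm = trans (E->>= (λ _ → 1ℚ) μ f) (trans (E-cong f-norm μ) μ-norm)

  concatMapᴰ-normalised : (f : A → Dist (List B)) → (∀ x → Normalised (f x)) →
                          ∀ xs → Normalised (concatMapᴰ f xs)
  concatMapᴰ-normalised f f-norm []       = refl
  concatMapᴰ-normalised f f-norm (x ∷ xs) =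
    >>=-normalised (f x) _ (f-norm x) λ ys →
    >>=-normalised (concatMapᴰ f xs) (λ zs → return (ys ++ zs)) (concatMapᴰ-normalised f f-norm xs) λ zs → refl

  -- Linearity of expectation. Length is additive under `_++_`, and each of the two summands is
  -- constant with respect to the other distribution, whose total weight 1 leaves it unchanged.
  E-size-concatMapᴰ : (f : A → Dist (List B)) → (∀ x → Normalised (f x)) →
                      ∀ xs → E size (concatMapᴰ f xs) ≡ ∑ (λ x → E size (f x)) xs
  E-size-concatMapᴰ f f-norm []       = refl
  E-size-concatMapᴰ f f-norm (x ∷ xs) = begin
    E size (concatMapᴰ f (x ∷ xs))
      ≡⟨ E->>= size (f x) (λ ys → rest >>= λ zs → return (ys ++ zs)) ⟩
    E (λ ys → E size (rest >>= λ zs → return (ys ++ zs))) (f x)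
      ≡⟨ E-cong append (f x) ⟩
    E (λ ys → size ys + E size rest) (f x)
      ≡⟨ E-+ size (λ _ → E size rest) (f x) ⟩
    E size (f x) + E (λ _ → E size rest) (f x)
      ≡⟨ cong (λ z → E size (f x) + z) (E-const (E size rest) (f x) (f-norm x)) ⟩
    E size (f x) + E size rest
      ≡⟨ cong (λ z → E size (f x) + z) (E-size-concatMapᴰ f f-norm xs) ⟩
    E size (f x) + ∑ (λ x → E size (f x)) xs ∎
    where
    open ≡-Reasoning
    rest = concatMapᴰ f xs
    append : ∀ ys → E size (rest >>= λ zs → return (ys ++ zs)) ≡ size ys + E size rest
    append ys = begin
      E size (rest >>= λ zs → return (ys ++ zs))
        ≡⟨ E->>= size rest (λ zs → return (ys ++ zs)) ⟩
      E (λ zs → E size (return (ys ++ zs))) rest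
        ≡⟨ E-cong (λ zs → trans (E-return size (ys ++ zs))
             (trans (cong ι (List.length-++ ys)) (ι-+ (length ys) (length zs)))) rest ⟩
      E (λ zs → size ys + size zs) rest
        ≡⟨ E-+ (λ _ → size ys) size rest ⟩
      E (λ _ → size ys) rest + E size rest
        ≡⟨ cong (_+ E size rest) (E-const (size ys) rest (concatMapᴰ-normalised f f-norm xs)) ⟩
      size ys + E size rest ∎

  bernoulli-normalised : ∀ q → Normalised (bernoulli q)
  bernoulli-normalised (q , _) =
    solve 1 (λ q → q :* con 1ℚ :+ ((con 1ℚ :+ :- q) :* con 1ℚ :+ con 0ℚ) := con 1ℚ) refl (seq q n)

  E-bernoulli-𝟙 : ∀ q → E 𝟙 (bernoulli q) ≡ seq (proj₁ q) n
  E-bernoulli-𝟙 (q , _) =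
    solve 1 (λ q → q :* con 1ℚ :+ ((con 1ℚ :+ :- q) :* con 0ℚ :+ con 0ℚ) := q) refl (seq q n)

-- Double counting

_∈ᵇ_ : ∀ {D} → Fin D → Document D → Bool
w ∈ᵇ t = does (w ∈? t)

∑-membership : ∀ {D} (t : Document D) → ∑ (λ w → 𝟙 (w ∈ᵇ t)) (allFin D) ≡ ι ∣ t ∣
∑-membership []          = refl
∑-membership (true ∷ t)  = trans (∑-allFin-suc (λ w → 𝟙 (w ∈ᵇ (true ∷ t))))
  (trans (cong (λ z → 1ℚ + z) (∑-membership t)) (sym (ι-+ 1 ∣ t ∣)))
∑-membership (false ∷ t) = trans (∑-allFin-suc (λ w → 𝟙 (w ∈ᵇ (false ∷ t))))
  (trans (+-identityˡ _) (∑-membership t))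

∑-documents : ∀ {D N} (w : Fin D) (T : Vec (Document D) N) →
              ∑ (λ t → 𝟙 (w ∈ᵇ t)) (toList T) ≡ ι (# w within T)
∑-documents w []      = refl
-- `count` branches on this same Boolean, so both sides reduce together.
∑-documents w (t ∷ T) with w ∈ᵇ t
... | true  = trans (cong (λ z → 1ℚ + z) (∑-documents w T)) (sym (ι-+ 1 (# w within T)))
... | false = trans (+-identityˡ _) (∑-documents w T)

-- Forgetting `v < w` adds the reversed and the diagonal pairs, whose terms are nonnegative. In
-- exchange the coefficients become products of one factor per word.
∑-wordPairs-≤ : ∀ {D} (t : Document D) (f : Fin D × Fin D → ℚ) → (∀ x → 0ℚ ℚ.≤ f x) →
  ∑ f (wordPairs t) ℚ.≤
  ∑ (λ v → ∑ (λ w → 𝟙 (v ∈ᵇ t) ℚ.* 𝟙 (w ∈ᵇ t) ℚ.* f (v , w)) (allFin D)) (allFin D)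
∑-wordPairs-≤ {D} t f 0≤f = ≤-trans (≤-reflexive (trans
    (∑-filter _ f (cartesianProduct (allFin D) (allFin D)))
    (∑-cartesianProduct _ (allFin D) (allFin D))))
  (∑-mono (λ v → ∑-mono (λ w → *-monoʳ-≤-nonNeg (f (v , w)) {{nonNegative (0≤f (v , w))}}
    -- The decision of the filter reduces to a nested `_∧_`, whose first conjunct is the order
    -- condition.
    (≤-trans (𝟙-∧-≤ʳ (does (v <ᶠ? w)) (v ∈ᵇ t ∧ w ∈ᵇ t)) (≤-reflexive (𝟙-∧ (v ∈ᵇ t) (w ∈ᵇ t)))))
    (allFin D)) (allFin D))

module _ (f g : A → ℚ) (xs : List A) where

  -- Splitting `g x + g y` gives two double sums, exchanged by swapping `x` and `y`; each factors
  -- into the same product, whence the 2.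
  ∑∑-symmetric : ∑ (λ x → ∑ (λ y → f x ℚ.* f y ℚ.* (g x + g y)) xs) xs ≡
                 ι 2 ℚ.* (∑ f xs ℚ.* ∑ (λ x → f x ℚ.* g x) xs)
  ∑∑-symmetric = begin
    ∑ (λ x → ∑ (λ y → f x ℚ.* f y ℚ.* (g x + g y)) xs) xs
      ≡⟨ ∑-cong row xs ⟩
    ∑ (λ x → f x ℚ.* g x ℚ.* F + f x ℚ.* G) xs
      ≡⟨ ∑-+ _ _ xs ⟩
    ∑ (λ x → f x ℚ.* g x ℚ.* F) xs + ∑ (λ x → f x ℚ.* G) xs
      ≡⟨ cong₂ _+_ (∑-*ʳ F _ xs) (∑-*ʳ G f xs) ⟩
    G ℚ.* F + F ℚ.* G
      ≡⟨ solve 2 (λ F G → G :* F :+ F :* G := con (ι 2) :* (F :* G)) refl F G ⟩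
    ι 2 ℚ.* (F ℚ.* G) ∎
    where
    open ≡-Reasoning
    F = ∑ f xs
    G = ∑ (λ x → f x ℚ.* g x) xs
    row : ∀ x → ∑ (λ y → f x ℚ.* f y ℚ.* (g x + g y)) xs ≡ f x ℚ.* g x ℚ.* F + f x ℚ.* G
    row x = begin
      ∑ (λ y → f x ℚ.* f y ℚ.* (g x + g y)) xs
        ≡⟨ ∑-cong (λ y → solve 4 (λ a b c d → a :* b :* (c :+ d) := a :* c :* b :+ a :* (b :* d))
             refl (f x) (f y) (g x) (g y)) xs ⟩
      ∑ (λ y → f x ℚ.* g x ℚ.* f y + f x ℚ.* (f y ℚ.* g y)) xs
        ≡⟨ ∑-+ _ _ xs ⟩
      ∑ (λ y → f x ℚ.* g x ℚ.* f y) xs + ∑ (λ y → f x ℚ.* (f y ℚ.* g y)) xs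
        ≡⟨ cong₂ _+_ (∑-*ˡ (f x ℚ.* g x) f xs) (∑-*ˡ (f x) _ xs) ⟩
      f x ℚ.* g x ℚ.* F + f x ℚ.* G ∎

-- Reciprocal counts summed over the documents

module _ {D N : ℕ} (T : Vec (Document D) N) where

  r : Fin D → ℚ
  r w = reciprocal (# w within T)

  documentWeight : Document D → ℚ
  documentWeight t = ∑ (λ w → 𝟙 (w ∈ᵇ t) ℚ.* r w) (allFin D)

  0≤documentWeight : ∀ t → 0ℚ ℚ.≤ documentWeight t
  0≤documentWeight t = subst (ℚ._≤ documentWeight t) (∑-zero (allFin D))
    (∑-mono (λ w → 0≤p*q (𝟙 (w ∈ᵇ t)) (r w) (0≤𝟙 (w ∈ᵇ t)) (0≤reciprocal (# w within T))) (allFin D))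

  -- Summing over documents first, each word `w` occurs `# w within T` times with weight `r w` and
  -- so contributes at most 1. The number of documents disappears here.
  ∑-documentWeight : ∑ documentWeight (toList T) ℚ.≤ ι D
  ∑-documentWeight = begin
    ∑ documentWeight (toList T)
      ≡⟨ ∑-swap (λ t w → 𝟙 (w ∈ᵇ t) ℚ.* r w) (toList T) (allFin D) ⟩
    ∑ (λ w → ∑ (λ t → 𝟙 (w ∈ᵇ t) ℚ.* r w) (toList T)) (allFin D)
      ≡⟨ ∑-cong (λ w → trans (∑-*ʳ (r w) _ (toList T))
           (trans (cong (ℚ._* r w) (∑-documents w T)) (*-comm _ (r w)))) (allFin D) ⟩
    ∑ (λ w → r w ℚ.* ι (# w within T)) (allFin D)
      ≤⟨ ∑-mono (λ w → reciprocal-*-≤1 (# w within T)) (allFin D) ⟩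
    ∑ (λ _ → 1ℚ) (allFin D)
      ≡⟨ ∑-one (allFin D) ⟩
    ι (length (allFin D))
      ≡⟨ cong ι (List.length-tabulate {n = D} id) ⟩
    ι D ∎
    where open ≤-Reasoning

  -- The symmetric sum factors into the size of `t` and its weight. Only the size is estimated by
  -- `L`; the weight is kept for the summation over documents.
  ∑-wordPairs-r : ∀ {L} t → ∣ t ∣ ≤ L →
    ∑ (λ (v , w) → r v + r w) (wordPairs t) ℚ.≤ ι 2 ℚ.* ι L ℚ.* documentWeight t
  ∑-wordPairs-r {L} t ∣t∣≤L = begin
    ∑ (λ (v , w) → r v + r w) (wordPairs t)
      ≤⟨ ∑-wordPairs-≤ t _ (λ (v , w) → +-mono-≤ {0ℚ} {r v} {0ℚ} {r w}
           (0≤reciprocal (# v within T)) (0≤reciprocal (# w within T))) ⟩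
    ∑ (λ v → ∑ (λ w → 𝟙 (v ∈ᵇ t) ℚ.* 𝟙 (w ∈ᵇ t) ℚ.* (r v + r w)) (allFin D)) (allFin D)
      ≡⟨ ∑∑-symmetric (λ w → 𝟙 (w ∈ᵇ t)) r (allFin D) ⟩
    ι 2 ℚ.* (∑ (λ w → 𝟙 (w ∈ᵇ t)) (allFin D) ℚ.* documentWeight t)
      ≡⟨ cong (λ z → ι 2 ℚ.* (z ℚ.* documentWeight t)) (∑-membership t) ⟩
    ι 2 ℚ.* (ι ∣ t ∣ ℚ.* documentWeight t)
      ≤⟨ *-monoˡ-≤-nonNeg (ι 2) (*-monoʳ-≤-nonNeg (documentWeight t)
           {{nonNegative (0≤documentWeight t)}} (ι-mono ∣t∣≤L)) ⟩
    ι 2 ℚ.* (ι L ℚ.* documentWeight t)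
      ≡⟨ *-assoc (ι 2) (ι L) (documentWeight t) ⟨
    ι 2 ℚ.* ι L ℚ.* documentWeight t ∎
    where open ≤-Reasoning

  ∑∑-wordPairs-r : ∀ {L} → All (λ t → ∣ t ∣ ≤ L) T →
    ∑ (λ t → ∑ (λ (v , w) → r v + r w) (wordPairs t)) (toList T) ℚ.≤ ι 2 ℚ.* ι (D * L)
  ∑∑-wordPairs-r {L} short = begin
    ∑ (λ t → ∑ (λ (v , w) → r v + r w) (wordPairs t)) (toList T)
      ≤⟨ ∑-mono-All (ListAll.map (λ {t} → ∑-wordPairs-r t) (All.toList⁺ short)) ⟩
    ∑ (λ t → ι 2 ℚ.* ι L ℚ.* documentWeight t) (toList T)
      ≡⟨ ∑-*ˡ (ι 2 ℚ.* ι L) documentWeight (toList T) ⟩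
    ι 2 ℚ.* ι L ℚ.* ∑ documentWeight (toList T)
      ≤⟨ *-monoˡ-≤-nonNeg (ι 2 ℚ.* ι L)
           {{nonNegative (0≤p*q (ι 2) (ι L) (0≤ι 2) (0≤ι L))}} ∑-documentWeight ⟩
    ι 2 ℚ.* ι L ℚ.* ι D
      ≡⟨ trans (*-assoc (ι 2) (ι L) (ι D)) (cong (ι 2 ℚ.*_) (*-comm (ι L) (ι D))) ⟩
    ι 2 ℚ.* (ι D ℚ.* ι L)
      ≡⟨ cong (ι 2 ℚ.*_) (ι-* D L) ⟨
    ι 2 ℚ.* ι (D * L) ∎
    where open ≤-Reasoning

  -- Emission probabilities and the shuffle size at a fixed index

  module _ (ε : ℝ) (0<ε : 0ᴿ <ᴿ ε) (n : ℕ) where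

    ℓ ε⁻¹ c : ℚ
    ℓ   = seq (log D) n
    ε⁻¹ = seq (inverse ε 0<ε) n
    c   = ι 2 ℚ.* ℓ ℚ.* ε⁻¹

    -- Holds at every index: the Riemann sums of `log` have positive terms, and `inverse` takes the
    -- reciprocal only after raising the approximation of `ε` to at least a positive rational.
    0≤c : 0ℚ ℚ.≤ c
    0≤c = 0≤p*q (ι 2 ℚ.* ℓ) ε⁻¹
      (0≤p*q (ι 2) ℓ (0≤ι 2) (0≤harmonic (ℕ.suc n) ((D ℕ.∸ 1) ℕ.* ℕ.suc n)))
      (<⇒≤ (recip-pos _ (0<p⊔δ (seq ε n) (proj₁ (proj₂ 0<ε)))))

    -- A name for the continuation inside `emitPair`, so that the laws for `_>>=_` can be applied to
    -- it.
    emitIf : Fin D × Fin D → Bool → Dist (List (KeyValue T ε 0<ε))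
    emitIf x heads = return (if heads then (x , 1) ∷ [] else [])

    emitPair-normalised : ∀ x → Normalised n (emitPair T ε 0<ε x)
    emitPair-normalised (v , w) = >>=-normalised n (bernoulli (emitProbability T ε 0<ε v w)) (emitIf (v , w))
      (bernoulli-normalised n (emitProbability T ε 0<ε v w)) (λ _ → refl)

    E-size-emitPair : ∀ v w → E n size (emitPair T ε 0<ε (v , w)) ℚ.≤ c ℚ.* (r v + r w)
    E-size-emitPair v w = begin
      E n size (emitPair T ε 0<ε (v , w))
        ≡⟨ E->>= n size (bernoulli P) (emitIf (v , w)) ⟩
      E n (λ heads → E n size (emitIf (v , w) heads)) (bernoulli P)
        ≡⟨ E-cong n size-emitIf (bernoulli P) ⟩
      E n 𝟙 (bernoulli P)
        ≡⟨ E-bernoulli-𝟙 n P ⟩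
      -- This is the `n`-th term of the emission probability by unfolding, since `c` is bracketed as
      -- in `emitProbability`.
      1ℚ ⊓ (c ℚ.* reciprocal (# v within T ℕ.⊓ # w within T))
        ≤⟨ p⊓q≤q 1ℚ _ ⟩
      c ℚ.* reciprocal (# v within T ℕ.⊓ # w within T)
        ≤⟨ *-monoˡ-≤-nonNeg c {{nonNegative 0≤c}} (reciprocal-⊓ (# v within T) (# w within T)) ⟩
      c ℚ.* (r v + r w) ∎
      where
      open ≤-Reasoning
      P = emitProbability T ε 0<ε v w
      size-emitIf : ∀ heads → E n size (emitIf (v , w) heads) ≡ 𝟙 heads
      size-emitIf true  = refl
      size-emitIf false = refl

    seq-expectedShuffleSize : seq (expectedShuffleSize T ε 0<ε) n ≡
      ∑ (λ t → ∑ (λ x → E n size (emitPair T ε 0<ε x)) (wordPairs t)) (toList T)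
    seq-expectedShuffleSize = begin
      seq (expectedShuffleSize T ε 0<ε) n
        ≡⟨ seq-expectation n (λ emitted → fromℕ (length emitted)) (mapPhase T ε 0<ε) ⟩
      E n size (mapPhase T ε 0<ε)
        ≡⟨ E-size-concatMapᴰ n (overlapSampleEmit T ε 0<ε) (λ t →
             concatMapᴰ-normalised n (emitPair T ε 0<ε) emitPair-normalised (wordPairs t)) (toList T) ⟩
      ∑ (λ t → E n size (overlapSampleEmit T ε 0<ε t)) (toList T)
        ≡⟨ ∑-cong (λ t → E-size-concatMapᴰ n (emitPair T ε 0<ε) emitPair-normalised (wordPairs t)) (toList T) ⟩
      ∑ (λ t → ∑ (λ x → E n size (emitPair T ε 0<ε x)) (wordPairs t)) (toList T) ∎
      where open ≡-Reasoning

    seq-expectedShuffleSize-≤ : ∀ {L} → All (λ t → ∣ t ∣ ≤ L) T →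
      seq (expectedShuffleSize T ε 0<ε) n ℚ.≤ ι 4 ℚ.* (ι (D * L) ℚ.* ℓ ℚ.* ε⁻¹)
    seq-expectedShuffleSize-≤ {L} short = begin
      seq (expectedShuffleSize T ε 0<ε) n
        ≡⟨ seq-expectedShuffleSize ⟩
      ∑ (λ t → ∑ (λ x → E n size (emitPair T ε 0<ε x)) (wordPairs t)) (toList T)
        ≤⟨ ∑-mono (λ t → ∑-mono (λ (v , w) → E-size-emitPair v w) (wordPairs t)) (toList T) ⟩
      ∑ (λ t → ∑ (λ (v , w) → c ℚ.* (r v + r w)) (wordPairs t)) (toList T)
        ≡⟨ ∑-cong (λ t → ∑-*ˡ c (λ (v , w) → r v + r w) (wordPairs t)) (toList T) ⟩
      ∑ (λ t → c ℚ.* ∑ (λ (v , w) → r v + r w) (wordPairs t)) (toList T)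
        ≡⟨ ∑-*ˡ c (λ t → ∑ (λ (v , w) → r v + r w) (wordPairs t)) (toList T) ⟩
      c ℚ.* ∑ (λ t → ∑ (λ (v , w) → r v + r w) (wordPairs t)) (toList T)
        ≤⟨ *-monoˡ-≤-nonNeg c {{nonNegative 0≤c}} (∑∑-wordPairs-r short) ⟩
      c ℚ.* (ι 2 ℚ.* ι (D * L))
        ≡⟨ solve 3 (λ l e d → con (ι 2) :* l :* e :* (con (ι 2) :* d) := con (ι 4) :* (d :* l :* e))
             refl ℓ ε⁻¹ (ι (D * L)) ⟩
      ι 4 ℚ.* (ι (D * L) ℚ.* ℓ ℚ.* ε⁻¹) ∎
      where open ≤-Reasoning

theorem8 : Σ[ C ∈ ℝ ]
    ((D L N : ℕ) → 2 ≤ D →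
    (T : Vec (Document D) N) → All (λ t → ∣ t ∣ ≤ L) T →
    (ε : ℝ) (0<ε : 0ᴿ <ᴿ ε) → ε ≤ᴿ 1ᴿ →
    expectedShuffleSize T ε 0<ε ≤ᴿ C *ᴿ (fromℕ (D * L) *ᴿ log D *ᴿ inverse ε 0<ε))
-- One factor 2 of the constant is the 2 in `oversampling`, the other comes from `∑∑-symmetric`. The
-- inequality holds at every index, so it passes to the reals termwise.
theorem8 = fromℕ 4 , λ D L N 2≤D T short ε 0<ε ε≤1 →
  termwise-≤ {expectedShuffleSize T ε 0<ε} {fromℕ 4 *ᴿ (fromℕ (D * L) *ᴿ log D *ᴿ inverse ε 0<ε)}
    λ n → seq-expectedShuffleSize-≤ T ε 0<ε n short
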